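{- There is an infinite word $\mathbf{w}$ over the binary alphabet $\{0,1\}$ such that $\mathbf{w}$ is $(5/2)^+$-free and its curling-number transform $C(\mathbf{w})$ is $3^+$-free.
   Context: Words are indexed from $0$; infinite words are one-sided, $\mathbf{w} = \mathbf{w}[0]\mathbf{w}[1]\cdots$; $x[i..j]$ denotes the factor (contiguous block) $x[i]\cdots x[j]$. A finite word $x$ of length $n \ge 1$ has period $p$, $1\le p\le n$, if $x[i]=x[i+p]$ for all $0\le i<n-p$; its exponent is $n/p$ where $p$ is its least period. A finite or infinite word is $\alpha^+$-free if it has no nonempty finite factor of exponent strictly greater than $\alpha$. The curling number of a nonempty finite word $u$ is the largest integer $k \ge 1$ such that $u = y z^k$ for some (possibly empty) word $y$ and some nonempty word $z$. For a finite or infinite word $x$, the curling-number transform $C(x)$ is the word over the positive integers, of the same length as $x$, whose $i$-th letter $C(x)[i]$ is the curling number of the prefix $x[0..i]$. -}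

module Defs where

open import Data.Empty using (⊥-elim)
open import Data.Fin using (Fin; toℕ)
open import Data.Integer using (+_)
open import Data.List using (List; []; _∷_; _++_; length; lookup; take; drop; replicate; concat; applyUpTo)
open import Data.List.Properties using (≡-dec; length-++; length-++-≤ˡ; length-++-≤ʳ; ++-identityʳ)
open import Data.Nat using (ℕ; zero; suc; _+_; _≤_; _<_; z≤n; s≤s; >-nonZero)
open import Data.Nat.Properties using (≤-refl; ≤-trans; ≤-reflexive; ≤-antisym; +-mono-≤; m≤n⇒m<n∨m≡n; anyUpTo?)
open import Data.Product using (Σ; ∃; ∃-syntax; _×_; _,_; proj₁; proj₂)
open import Data.Rational as ℚ using (ℚ)
open import Data.Sum using (inj₁; inj₂)
open import Level using (Level)
open import Relation.Binary.Definitions using (DecidableEquality)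
open import Relation.Binary.PropositionalEquality using (_≡_; _≢_; refl; sym; trans; cong; cong₂; subst)
open import Relation.Nullary using (Dec; yes; no; ¬_; ¬?; _×-dec_; map′)

private
  variable
    a : Level
    A : Set a

InfiniteWord : Set a → Set a
InfiniteWord A = ℕ → A

-- The block of length n starting at position i, i.e. w[i..i+n-1].
factor : InfiniteWord A → ℕ → ℕ → List A
factor w i n = applyUpTo (λ j → w (i + j)) n

IsFactorOf : List A → InfiniteWord A → Set _
IsFactorOf x w = ∃[ i ] ∃[ n ] x ≡ factor w i n

record HasPeriod {A : Set a} (x : List A) (p : ℕ) : Set a where
  field
    1≤p      : 1 ≤ p
    p≤length : p ≤ length x
    periodic : ∀ (i j : Fin (length x)) → toℕ j ≡ toℕ i + p → lookup x i ≡ lookup x j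

record IsLeastPeriod {A : Set a} (x : List A) (p : ℕ) : Set a where
  field
    hasPeriod : HasPeriod x p
    least     : ∀ q → HasPeriod x q → p ≤ q

  open HasPeriod hasPeriod public

HasExponent : List A → ℚ → Set _
HasExponent x e = ∃[ p ] Σ (IsLeastPeriod x p) λ lp →
  e ≡ ℚ._/_ (+ length x) p {{>-nonZero (IsLeastPeriod.1≤p lp)}}

infix 4 _⁺-free_

_⁺-free_ : ℚ → InfiniteWord A → Set _
α ⁺-free w = ¬ (∃[ x ] IsFactorOf x w × x ≢ [] × ∃[ e ] HasExponent x e × α ℚ.< e)

infixr 8 _^_

_^_ : List A → ℕ → List A
z ^ k = concat (replicate k z)

EndsInPower : List A → ℕ → Set _
EndsInPower u k = ∃[ y ] ∃[ z ] z ≢ [] × u ≡ y ++ z ^ k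

record IsCurlingNumber {A : Set a} (u : List A) (k : ℕ) : Set a where
  field
    1≤k     : 1 ≤ k
    power   : EndsInPower u k
    largest : ∀ j → 1 ≤ j → EndsInPower u j → j ≤ k

IsCurlingNumber-unique : ∀ {u : List A} {k l} → IsCurlingNumber u k → IsCurlingNumber u l → k ≡ l
IsCurlingNumber-unique p q =
  ≤-antisym (Q.largest _ P.1≤k P.power) (P.largest _ Q.1≤k Q.power)
  where
  module P = IsCurlingNumber p
  module Q = IsCurlingNumber q

private
  1≤length : ∀ {z : List A} → z ≢ [] → 1 ≤ length z
  1≤length {z = []}    z≢[] = ⊥-elim (z≢[] refl)
  1≤length {z = _ ∷ _} _    = s≤s z≤n

  k≤length-^ : ∀ {z : List A} k → z ≢ [] → k ≤ length (z ^ k)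
  k≤length-^         zero    _    = z≤n
  k≤length-^ {z = z} (suc k) z≢[] =
    ≤-trans (+-mono-≤ (1≤length z≢[]) (k≤length-^ k z≢[])) (≤-reflexive (sym (length-++ z)))

  EndsInPower⇒≤length : ∀ {u : List A} {k} → EndsInPower u k → k ≤ length u
  EndsInPower⇒≤length {k = k} (y , z , z≢[] , refl) = ≤-trans (k≤length-^ k z≢[]) (length-++-≤ʳ (z ^ k) {y})

  endsInFirstPower : ∀ {u : List A} → u ≢ [] → EndsInPower u 1
  endsInFirstPower {u = u} u≢[] = [] , u , u≢[] , sym (++-identityʳ u)

  take-length-++ : ∀ (xs : List A) {ys} → take (length xs) (xs ++ ys) ≡ xs
  take-length-++ []       = refl
  take-length-++ (x ∷ xs) = cong (x ∷_) (take-length-++ xs)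

  drop-length-++ : ∀ (xs : List A) {ys} → drop (length xs) (xs ++ ys) ≡ ys
  drop-length-++ []       = refl
  drop-length-++ (x ∷ xs) = drop-length-++ xs

module _ {A : Set a} (_≟_ : DecidableEquality A) where

  private
    SplitsAt : List A → ℕ → ℕ → ℕ → Set a
    SplitsAt u k i d = let z = take d (drop i u) in z ≢ [] × u ≡ take i u ++ z ^ k

    splitsAt : ∀ (y z : List A) k → z ≢ [] → SplitsAt (y ++ z ^ suc k) (suc k) (length y) (length z)
    splitsAt y z k z≢[] =
      subst (_≢ []) (sym z-eq) z≢[] ,
      sym (cong₂ (λ s t → s ++ t ^ suc k) (take-length-++ y) z-eq)
      where
      z-eq : take (length z) (drop (length y) (y ++ z ^ suc k)) ≡ z
      z-eq = trans (cong (take (length z)) (drop-length-++ y)) (take-length-++ z)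

    endsInPower? : ∀ u k → Dec (EndsInPower u (suc k))
    endsInPower? u k = map′ to from
      (anyUpTo? (λ i → anyUpTo? (λ d → ¬? (≡-dec _≟_ _ []) ×-dec ≡-dec _≟_ u _) (suc (length u))) (suc (length u)))
      where
      to : (∃[ i ] i < suc (length u) × ∃[ d ] d < suc (length u) × SplitsAt u (suc k) i d) →
           EndsInPower u (suc k)
      to (i , _ , d , _ , z≢[] , eq) = take i u , take d (drop i u) , z≢[] , eq

      from : EndsInPower u (suc k) →
             ∃[ i ] i < suc (length u) × ∃[ d ] d < suc (length u) × SplitsAt u (suc k) i d
      from (y , z , z≢[] , refl) =
        length y , s≤s (length-++-≤ˡ y) ,
        length z , s≤s (≤-trans (length-++-≤ˡ z) (length-++-≤ʳ (z ^ suc k) {y})) ,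
        splitsAt y z k z≢[]

    search : ∀ u → u ≢ [] → ∀ b → (∀ j → 1 ≤ j → EndsInPower u j → j ≤ b) → ∃ (IsCurlingNumber u)
    search u u≢[] zero bound with () ← bound 1 ≤-refl (endsInFirstPower u≢[])
    search u u≢[] (suc b) bound with endsInPower? u b
    ... | yes p = suc b , record { 1≤k = s≤s z≤n ; power = p ; largest = bound }
    ... | no ¬p = search u u≢[] b bound′
      where
      bound′ : ∀ j → 1 ≤ j → EndsInPower u j → j ≤ b
      bound′ j 1≤j q with m≤n⇒m<n∨m≡n (bound j 1≤j q)
      ... | inj₁ (s≤s j≤b) = j≤b
      ... | inj₂ refl      = ⊥-elim (¬p q)

    curling : ∀ u → u ≢ [] → ∃ (IsCurlingNumber u)
    curling u u≢[] = search u u≢[] (length u) (λ _ _ → EndsInPower⇒≤length)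

  curlingNumber : (u : List A) → u ≢ [] → ℕ
  curlingNumber u u≢[] = proj₁ (curling u u≢[])

  curlingNumber-correct : ∀ u u≢[] → IsCurlingNumber u (curlingNumber u u≢[])
  curlingNumber-correct u u≢[] = proj₂ (curling u u≢[])

  -- The prefix w[0..i] includes position i, hence has length suc i.
  C : InfiniteWord A → InfiniteWord ℕ
  C w i = curlingNumber (factor w 0 (suc i)) λ ()

{-# OPTIONS --safe #-}
module Submission where

-- The witness is w = h(t), where t is the squarefree fixed point of Leech's 13-uniform ternary morphism and h is a
-- 49-uniform binary morphism found by computer search. All squares in w have period at most 5, so a letter of C(w)
-- depends only on the last ten letters of w up to its position; moreover h is such that after its first 49 letters C(w) is again a
-- 49-uniform image of t. For each of the three morphisms, a square of long period in the image descends to a square in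
-- t, because a prefix of a block only occurs at block boundaries. Shorter periods only involve images of factors of t
-- of length 4 and are excluded by computation.

open import Defs
open import Data.Bool using (Bool; true; false; T; T?; _∧_; not; if_then_else_)
open import Data.Bool.Properties using (T-∧)
open import Data.Empty using (⊥)
import Data.Fin
open import Data.Fin using (Fin; toℕ; fromℕ<; _≟_)
open import Data.Fin.Patterns using (0F; 1F; 2F)
open import Data.Fin.Properties using (all?; toℕ<n; toℕ-fromℕ<; toℕ-injective)
open import Data.Integer as ℤ using (+_)
open import Data.Integer.Properties using (drop‿+<+; pos-*)
open import Data.List using (List; []; _∷_; _++_; length; take; drop; concatMap; applyUpTo; lookup)
open import Data.List.Properties using (≡-dec; ∷-injective; ++-identityʳ; length-++; length-applyUpTo; lookup-applyUpTo; drop-drop)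
open import Data.Nat using (ℕ; zero; suc; _+_; _*_; _∸_; _≤_; _<_; _≤ᵇ_; _≤?_; _<?_; z≤n; s≤s; s≤s⁻¹; NonZero; ≢-nonZero)
open import Data.Nat.Divisibility using (_∣_; divides; divides-refl; ∣m+n∣m⇒∣n)
import Data.Nat as ℕ
open import Data.Nat.DivMod using (_%_; /-monoˡ-≤; m<n*o⇒m/o<n; _mod_; m≡m%n+[m/n]*n; m%n<n; m/n*n≤m; m*n/n≡m; m/n<m; m<n⇒m/n≡0; m<n⇒m%n≡m; [m+kn]%n≡m%n; +-distrib-/-∣ˡ)
open import Data.Nat.Induction using (<-rec)
open import Data.Nat.Properties hiding (_≟_)
open import Data.Nat.Tactic.RingSolver using (solve-∀)
open import Data.Product using (∃-syntax; Σ-syntax; _×_; _,_; proj₁; proj₂)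
open import Data.Rational using (_/_)
import Data.Rational as ℚ
import Data.Rational.Properties as ℚ
import Data.Rational.Unnormalised as ℚᵘ
import Data.Rational.Unnormalised.Properties as ℚᵘ
open import Data.Sum using (_⊎_; inj₁; inj₂)
open import Data.Vec as Vec using (Vec; []; _∷_)
open import Function using (_∘_; id)
open import Function.Bundles using (module Equivalence)
open import Level using (Level)
open import Relation.Binary.Definitions using (DecidableEquality)
open import Relation.Binary.PropositionalEquality
open import Relation.Nullary using (Dec; yes; no; does; ¬_; ¬?; _×-dec_; _→-dec_; contradiction)
open import Relation.Nullary.Decidable using (toWitness; map′)

private
  variable
    a : Level
    A : Set a

-- Factors of infinite words.

+-swapʳ : ∀ x y z → x + y + z ≡ x + z + y
+-swapʳ = solve-∀

m≡[m/n]*n+m%n : ∀ m n .{{_ : NonZero n}} → m ≡ (m ℕ./ n) * n + m % n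
m≡[m/n]*n+m%n m n = trans (m≡m%n+[m/n]*n m n) (+-comm (m % n) _)

applyUpTo-cong : ∀ {f g : ℕ → A} n → (∀ {j} → j < n → f j ≡ g j) → applyUpTo f n ≡ applyUpTo g n
applyUpTo-cong zero    f≗g = refl
applyUpTo-cong (suc n) f≗g = cong₂ _∷_ (f≗g (s≤s z≤n)) (applyUpTo-cong n (f≗g ∘ s≤s))

applyUpTo-injective : ∀ {f g : ℕ → A} n → applyUpTo f n ≡ applyUpTo g n → ∀ {j} → j < n → f j ≡ g j
applyUpTo-injective (suc n) eq {zero}  _         = proj₁ (∷-injective eq)
applyUpTo-injective (suc n) eq {suc j} (s≤s j<n) = applyUpTo-injective n (proj₂ (∷-injective eq)) j<n

applyUpTo-++ : ∀ (f : ℕ → A) m n → applyUpTo f (m + n) ≡ applyUpTo f m ++ applyUpTo (f ∘ (λ j → m + j)) n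
applyUpTo-++ f zero    n = refl
applyUpTo-++ f (suc m) n = cong (f 0 ∷_) (applyUpTo-++ (f ∘ suc) m n)

take-applyUpTo : ∀ (f : ℕ → A) {m n} → m ≤ n → take m (applyUpTo f n) ≡ applyUpTo f m
take-applyUpTo f z≤n       = refl
take-applyUpTo f (s≤s m≤n) = cong (f 0 ∷_) (take-applyUpTo (f ∘ suc) m≤n)

drop-applyUpTo : ∀ (f : ℕ → A) m n → drop m (applyUpTo f n) ≡ applyUpTo (f ∘ (λ j → m + j)) (n ∸ m)
drop-applyUpTo f zero    n       = refl
drop-applyUpTo f (suc m) zero    = refl
drop-applyUpTo f (suc m) (suc n) = drop-applyUpTo (f ∘ suc) m n

factor-++ : ∀ (w : InfiniteWord A) i m n → factor w i (m + n) ≡ factor w i m ++ factor w (i + m) n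
factor-++ w i m n = trans (applyUpTo-++ _ m n)
  (cong (factor w i m ++_) (applyUpTo-cong n λ {j} _ → cong w (sym (+-assoc i m j))))

factor-suc : ∀ (w : InfiniteWord A) i n → factor w i (suc n) ≡ w i ∷ factor w (suc i) n
factor-suc w i n = cong₂ _∷_ (cong w (+-identityʳ i)) (applyUpTo-cong n λ {j} _ → cong w (+-suc i j))

factor-pair : ∀ (w : InfiniteWord A) i → factor w i 2 ≡ w i ∷ w (suc i) ∷ []
factor-pair w i = trans (factor-suc w i 1) (cong (w i ∷_) (factor-suc w (suc i) 0))

take-drop-factor : ∀ (w : InfiniteWord A) i r {l n} → r + l ≤ n →
                   take l (drop r (factor w i n)) ≡ factor w (i + r) l
take-drop-factor w i r {l} {n} r+l≤n = begin
  take l (drop r (factor w i n))                     ≡⟨ cong (take l) (drop-applyUpTo _ r n) ⟩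
  take l (applyUpTo (λ j → w (i + (r + j))) (n ∸ r)) ≡⟨ take-applyUpTo _ (m+n≤o⇒m≤o∸n l (subst (_≤ n) (+-comm r l) r+l≤n)) ⟩
  applyUpTo (λ j → w (i + (r + j))) l                ≡⟨ applyUpTo-cong l (λ {j} _ → cong w (sym (+-assoc i r j))) ⟩
  factor w (i + r) l                                 ∎
  where open ≡-Reasoning

applyUpTo-++⁻ : ∀ (f : ℕ → A) {n} xs {ys} → applyUpTo f n ≡ xs ++ ys →
                xs ≡ applyUpTo f (length xs) × ys ≡ applyUpTo (f ∘ (λ j → length xs + j)) (length ys)
applyUpTo-++⁻ f {n}     []       refl = refl , cong (applyUpTo f) (sym (length-applyUpTo f n))
applyUpTo-++⁻ f {suc n} (x ∷ xs) eq
  with refl , eq′ ← ∷-injective eq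
  with xs≡ , ys≡ ← applyUpTo-++⁻ (f ∘ suc) xs eq′ = cong (f 0 ∷_) xs≡ , ys≡

factor-++⁻ : ∀ (w : InfiniteWord A) i {n} xs {ys} → factor w i n ≡ xs ++ ys →
             xs ≡ factor w i (length xs) × ys ≡ factor w (i + length xs) (length ys)
factor-++⁻ w i xs {ys} eq
  with xs≡ , ys≡ ← applyUpTo-++⁻ _ xs eq =
  xs≡ , trans ys≡ (applyUpTo-cong (length ys) λ {j} _ → cong w (sym (+-assoc i (length xs) j)))

-- Repetitions and squares.

-- A block of length `p + l` with period `p`: the case `l = p` is a square, and `(p + l) / p`
-- exceeds `e` exactly when `l > (e - 1) * p`.
Repeats : {A : Set a} → InfiniteWord A → (p i l : ℕ) → Set a
Repeats w p i l = factor w i l ≡ factor w (i + p) l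

Repeats-cong : ∀ (w v : InfiniteWord A) {p} i k {l} → (∀ j → w (i + j) ≡ v (k + j)) →
               Repeats w p i l → Repeats v p k l
Repeats-cong w v {p} i k {l} w≗v rep = applyUpTo-cong l λ {j} j<l → begin
  v (k + j)       ≡⟨ w≗v j ⟨
  w (i + j)       ≡⟨ applyUpTo-injective l rep j<l ⟩
  w (i + p + j)   ≡⟨ cong w (+-assoc i p j) ⟩
  w (i + (p + j)) ≡⟨ w≗v (p + j) ⟩
  v (k + (p + j)) ≡⟨ cong v (+-assoc k p j) ⟨
  v (k + p + j)   ∎
  where open ≡-Reasoning

Repeats-sub : ∀ (w : InfiniteWord A) {p i l x n} → Repeats w p i l → i ≤ x → x + n ≤ i + l → Repeats w p x n
Repeats-sub w {p} {i} {l} {x} {n} rep i≤x x+n≤i+l = begin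
  factor w x n                          ≡⟨ cong (λ y → factor w y n) i+d≡x ⟨
  factor w (i + d) n                    ≡⟨ take-drop-factor w i d d+n≤l ⟨
  take n (drop d (factor w i l))        ≡⟨ cong (take n ∘ drop d) rep ⟩
  take n (drop d (factor w (i + p) l))  ≡⟨ take-drop-factor w (i + p) d d+n≤l ⟩
  factor w (i + p + d) n                ≡⟨ cong (λ y → factor w y n) (trans (+-swapʳ i p d) (cong (_+ p) i+d≡x)) ⟩
  factor w (x + p) n                    ∎
  where
  open ≡-Reasoning
  d = x ∸ i
  i+d≡x : i + d ≡ x
  i+d≡x = m+[n∸m]≡n i≤x
  d+n≤l : d + n ≤ l
  d+n≤l = +-cancelˡ-≤ i _ _ (subst (_≤ i + l) (trans (cong (_+ n) (sym i+d≡x)) (+-assoc i d n)) x+n≤i+l)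

Repeats-prefix : ∀ (w : InfiniteWord A) {p i l n} → Repeats w p i l → n ≤ l → Repeats w p i n
Repeats-prefix w {i = i} rep n≤l = Repeats-sub w rep ≤-refl (+-monoʳ-≤ i n≤l)

SquareFreeUpTo : ℕ → InfiniteWord A → Set _
SquareFreeUpTo P w = ∀ {p} → p < P → ∀ i → ¬ Repeats w (suc p) i (suc p)

SquareFree : InfiniteWord A → Set _
SquareFree w = ∀ p i → ¬ Repeats w (suc p) i (suc p)

-- Finite tests for repetitions.

-- The periods excluded are 1, …, P: the bound variable p is the period minus one, here and below.
Avoids : {A : Set a} → (ℕ → ℕ) → ℕ → List A → Set a
Avoids l P x = ∀ {p} → p < P → take (l (suc p)) x ≢ take (l (suc p)) (drop (suc p) x)

avoids? : DecidableEquality A → ∀ l P (x : List A) → Dec (Avoids l P x)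
avoids? _≟_ l P x = allUpTo? (λ p → ¬? (≡-dec _≟_ _ _)) P

-- A Boolean test implying Avoids; unlike avoids? it is fast enough for images of words.
module _ {A : Set a} (_≟A_ : DecidableEquality A) where

  agree : ℕ → List A → List A → Bool
  agree zero    _        _        = true
  agree (suc l) []       []       = true
  agree (suc l) []       (_ ∷ _)  = false
  agree (suc l) (_ ∷ _)  []       = false
  agree (suc l) (x ∷ xs) (y ∷ ys) = does (x ≟A y) ∧ agree l xs ys

  -- The test is used negated, so equal prefixes have to yield `true`; the answer `false` then
  -- certifies that they differ.
  agree-complete : ∀ l xs ys → take l xs ≡ take l ys → T (agree l xs ys)
  agree-complete zero    _        _        _  = _
  agree-complete (suc l) []       []       _  = _
  agree-complete (suc l) (x ∷ xs) (y ∷ ys) eq with refl , eq′ ← ∷-injective eq with x ≟A x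
  ... | yes _  = agree-complete l xs ys eq′
  ... | no x≢x = contradiction refl x≢x

  -- `ys` loses one letter whenever the period `p` grows by one, so no shift is computed from
  -- scratch.
  avoidsFrom : (ℕ → ℕ) → (p n : ℕ) (xs ys : List A) → Bool
  avoidsFrom l p zero    xs ys = true
  avoidsFrom l p (suc n) xs ys = not (agree (l p) xs ys) ∧ avoidsFrom l (suc p) n xs (drop 1 ys)

  avoidsFrom-sound : ∀ l p n xs ys → T (avoidsFrom l p n xs ys) →
                     ∀ {j} → j < n → take (l (j + p)) xs ≢ take (l (j + p)) (drop j ys)
  avoidsFrom-sound l p (suc n) xs ys ok {j} j<n eq with agree (l p) xs ys in agrees
  avoidsFrom-sound l p (suc n) xs ys ok {zero} _ eq | false = subst T agrees (agree-complete (l p) xs ys eq)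
  avoidsFrom-sound l p (suc n) xs ys ok {suc j} (s≤s j<n) eq | false =
    avoidsFrom-sound l (suc p) n xs (drop 1 ys) ok j<n
      (subst₂ (λ k zs → take (l k) xs ≡ take (l k) zs) (sym (+-suc j p)) (sym (drop-drop 1 j ys)) eq)

  avoidsᵇ : (ℕ → ℕ) → ℕ → List A → Bool
  avoidsᵇ l P xs = avoidsFrom l 1 P xs (drop 1 xs)

  avoidsᵇ-sound : ∀ l P xs → T (avoidsᵇ l P xs) → Avoids l P xs
  avoidsᵇ-sound l P xs ok {p} p<P eq = avoidsFrom-sound l 1 P xs (drop 1 xs) ok p<P
    (subst₂ (λ k zs → take (l k) xs ≡ take (l k) zs) (+-comm 1 p) (sym (drop-drop 1 p xs)) eq)

  tailsAvoid : (ℕ → ℕ) → ℕ → ℕ → List A → Bool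
  tailsAvoid l P zero    xs = true
  tailsAvoid l P (suc n) xs = avoidsᵇ l P xs ∧ tailsAvoid l P n (drop 1 xs)

  tailsAvoid-sound : ∀ l P n xs → T (tailsAvoid l P n xs) → ∀ {r} → r < n → Avoids l P (drop r xs)
  tailsAvoid-sound l P (suc n) xs ok {zero}  _         = avoidsᵇ-sound l P xs (proj₁ (Equivalence.to T-∧ ok))
  tailsAvoid-sound l P (suc n) xs ok {suc r} (s≤s r<n) =
    subst (Avoids l P) (drop-drop 1 r xs) (tailsAvoid-sound l P n (drop 1 xs) (proj₂ (Equivalence.to T-∧ ok)) r<n)

-- Since `take` truncates silently, the finite test speaks about `w` only if the repetition lies
-- inside the window of length `n`.
Avoids⇒¬Repeats : ∀ (w : InfiniteWord A) l i r n {x P} → factor w i n ≡ x → Avoids l P (drop r x) →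
                  ∀ {p} → p < P → r + (suc p + l (suc p)) ≤ n → ¬ Repeats w (suc p) (i + r) (l (suc p))
Avoids⇒¬Repeats w l i r n refl avoids {p} p<P fits rep = avoids p<P (begin
  take k (drop r (factor w i n))                ≡⟨ take-drop-factor w i r (≤-trans (+-monoʳ-≤ r (m≤n+m k (suc p))) fits) ⟩
  factor w (i + r) k                            ≡⟨ rep ⟩
  factor w (i + r + suc p) k                    ≡⟨ cong (λ y → factor w y k) (+-assoc i r (suc p)) ⟩
  factor w (i + (r + suc p)) k                  ≡⟨ take-drop-factor w i (r + suc p) (subst (_≤ n) (sym (+-assoc r (suc p) k)) fits) ⟨
  take k (drop (r + suc p) (factor w i n))      ≡⟨ cong (take k) (drop-drop r (suc p) _) ⟨
  take k (drop (suc p) (drop r (factor w i n))) ∎)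
  where
  open ≡-Reasoning
  k = l (suc p)

¬Repeats⇒Avoids : ∀ (w : InfiniteWord A) l {P} i r n → (∀ {p} → p < P → ¬ Repeats w (suc p) (i + r) (l (suc p))) →
                  (∀ {p} → p < P → r + (suc p + l (suc p)) ≤ n) → Avoids l P (drop r (factor w i n))
¬Repeats⇒Avoids w l i r n ¬rep fits {p} p<P eq = ¬rep p<P (begin
  factor w (i + r) k                            ≡⟨ take-drop-factor w i r (≤-trans (+-monoʳ-≤ r (m≤n+m k (suc p))) (fits p<P)) ⟨
  take k (drop r (factor w i n))                ≡⟨ eq ⟩
  take k (drop (suc p) (drop r (factor w i n))) ≡⟨ cong (take k) (drop-drop r (suc p) _) ⟩
  take k (drop (r + suc p) (factor w i n))      ≡⟨ take-drop-factor w i (r + suc p) (subst (_≤ n) (sym (+-assoc r (suc p) k)) (fits p<P)) ⟩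
  factor w (i + (r + suc p)) k                  ≡⟨ cong (λ y → factor w y k) (+-assoc i r (suc p)) ⟨
  factor w (i + r + suc p) k                    ∎)
  where
  open ≡-Reasoning
  k = l (suc p)

-- For words of length 4 this is squarefreeness, since a square in them has period 1 or 2.
Admissible : List (Fin 3) → Set
Admissible u = (∀ {r} → r < 3 → Avoids id 1 (drop r u)) × Avoids id 2 u

admissible? : ∀ u → Dec (Admissible u)
admissible? u = allUpTo? (λ r → avoids? _≟_ id 1 (drop r u)) 3 ×-dec avoids? _≟_ id 2 u

-- Only periods 1 and 2 are assumed, so this applies to `ternary` before its full squarefreeness is
-- known.
factor-admissible : ∀ t → SquareFreeUpTo 2 t → ∀ i → Admissible (factor t i 4)
factor-admissible t sf i =
  (λ {r} r<3 → ¬Repeats⇒Avoids t id i r 4 (λ { (s≤s z≤n) → sf (s≤s z≤n) _ }) (λ { (s≤s z≤n) → +-monoˡ-≤ 2 (s≤s⁻¹ r<3) })) ,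
  ¬Repeats⇒Avoids t id i 0 4 (λ p<2 → sf p<2 _) (λ p<2 → +-mono-≤ p<2 p<2)

≡⇒Repeats : ∀ (w : InfiniteWord A) n → w n ≡ w (suc n) → Repeats w 1 n 1
≡⇒Repeats w n eq = cong (_∷ [])
  (trans (cong w (+-identityʳ n)) (trans eq (cong w (sym (trans (+-identityʳ (n + 1)) (+-comm n 1))))))

-- Images under uniform morphisms on three letters.

module _ {A : Set a} {q : ℕ} .{{_ : NonZero q}} (φ : Fin 3 → Vec A q) where

  blocks : List (Fin 3) → List A
  blocks = concatMap (Vec.toList ∘ φ)

  opaque
    image : InfiniteWord (Fin 3) → InfiniteWord A
    image t n = Vec.lookup (φ (t (n ℕ./ q))) (n mod q)

  opaque
    unfolding image

    image-lookup : ∀ t c (r : Fin q) → image t (c * q + toℕ r) ≡ Vec.lookup (φ (t c)) r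
    image-lookup t c r = cong₂ (λ c r → Vec.lookup (φ (t c)) r) quotient (toℕ-injective remainder)
      where
      open ≡-Reasoning
      quotient : (c * q + toℕ r) ℕ./ q ≡ c
      quotient = begin
        (c * q + toℕ r) ℕ./ q            ≡⟨ +-distrib-/-∣ˡ (toℕ r) (divides-refl c) ⟩
        c * q ℕ./ q + toℕ r ℕ./ q        ≡⟨ cong₂ _+_ (m*n/n≡m c q) (m<n⇒m/n≡0 (toℕ<n r)) ⟩
        c + 0                            ≡⟨ +-identityʳ c ⟩
        c                                ∎
      remainder : toℕ ((c * q + toℕ r) mod q) ≡ toℕ r
      remainder = begin
        toℕ ((c * q + toℕ r) mod q) ≡⟨ toℕ-fromℕ< (m%n<n (c * q + toℕ r) q) ⟩
        (c * q + toℕ r) % q         ≡⟨ cong (_% q) (+-comm (c * q) (toℕ r)) ⟩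
        (toℕ r + c * q) % q         ≡⟨ [m+kn]%n≡m%n (toℕ r) c q ⟩
        toℕ r % q                   ≡⟨ m<n⇒m%n≡m (toℕ<n r) ⟩
        toℕ r                       ∎

  image-blocks : ∀ t c k → factor (image t) (c * q) (k * q) ≡ blocks (factor t c k)
  image-blocks t c zero    = refl
  image-blocks t c (suc k) = begin
    factor (image t) (c * q) (q + k * q)
      ≡⟨ factor-++ (image t) (c * q) q (k * q) ⟩
    factor (image t) (c * q) q ++ factor (image t) (c * q + q) (k * q)
      ≡⟨ cong₂ _++_ (applyUpTo-lookup (φ (t c)) (image-lookup t c))
                    (trans (cong (λ i → factor (image t) i (k * q)) (+-comm (c * q) q)) (image-blocks t (suc c) k)) ⟩
    blocks (t c ∷ factor t (suc c) k)
      ≡⟨ cong blocks (factor-suc t c k) ⟨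
    blocks (factor t c (suc k)) ∎
    where
    open ≡-Reasoning
    applyUpTo-lookup : ∀ {n} {f : ℕ → A} (xs : Vec A n) → (∀ r → f (toℕ r) ≡ Vec.lookup xs r) → applyUpTo f n ≡ Vec.toList xs
    applyUpTo-lookup []       f≗ = refl
    applyUpTo-lookup (x ∷ xs) f≗ = cong₂ _∷_ (f≗ 0F) (applyUpTo-lookup xs (f≗ ∘ Data.Fin.suc))

  image-factor : ∀ t c k {x r l} → x ≡ c * q + r → r + l ≤ k * q →
                 factor (image t) x l ≡ take l (drop r (blocks (factor t c k)))
  image-factor t c k {r = r} {l} refl r+l≤kq =
    trans (sym (take-drop-factor (image t) (c * q) r r+l≤kq)) (cong (take l ∘ drop r) (image-blocks t c k))

  -- `sync` pins occurrences of a block prefix to block boundaries; `b ≢ c` is harmless, as adjacent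
  -- letters of a squarefree word differ. The cut at `mid` leaves two pieces that each determine the
  -- letter, so a block only partly covered by a square can still be identified.
  record Recognizable (ℓ mid : ℕ) : Set a where
    constructor recognizable
    field
      ℓ≤q    : ℓ ≤ q
      mid≤q  : mid ≤ q
      sync   : ∀ b c d → b ≢ c → ∀ {r} → r < q →
               take ℓ (drop r (blocks (b ∷ c ∷ []))) ≡ take ℓ (blocks (d ∷ [])) → r ≡ 0
      prefix : ∀ b c → take mid (blocks (b ∷ [])) ≡ take mid (blocks (c ∷ [])) → b ≡ c
      suffix : ∀ b c → take (q ∸ mid) (drop mid (blocks (b ∷ []))) ≡ take (q ∸ mid) (drop mid (blocks (c ∷ []))) → b ≡ c

  recognizable? : DecidableEquality A → ∀ ℓ mid → Dec (Recognizable ℓ mid)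
  recognizable? _≟A_ ℓ mid = map′
    (λ (ℓ≤q , mid≤q , sync , prefix , suffix) → recognizable ℓ≤q mid≤q sync prefix suffix)
    (λ (recognizable ℓ≤q mid≤q sync prefix suffix) → ℓ≤q , mid≤q , sync , prefix , suffix)
    (ℓ ≤? q ×-dec mid ≤? q ×-dec
     (all? λ b → all? λ c → all? λ d → ¬? (b ≟ c) →-dec allUpTo? (λ r → ≡-dec _≟A_ _ _ →-dec r ℕ.≟ 0) q) ×-dec
     (all? λ b → all? λ c → ≡-dec _≟A_ _ _ →-dec b ≟ c) ×-dec
     (all? λ b → all? λ c → ≡-dec _≟A_ _ _ →-dec b ≟ c))

  -- A window of q + ℓ letters contains the first ℓ letters of a block, so p is a multiple of q.
  -- If the square starts in the first mid letters of a block it covers the block suffixes that follow, and otherwise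
  -- the prefixes of the next blocks; in both cases m consecutive letters of t equal those m later.
  square-descent : ∀ t {ℓ mid p i} → Recognizable ℓ mid → (∀ n → t n ≢ t (suc n)) → q + ℓ ≤ p →
                   Repeats (image t) p i p → ∃[ m ] ∃[ c ] p ≡ m * q × Repeats t m c m
  square-descent t {ℓ} {mid} {p} {i} R t≢ q+ℓ≤p rep = m , descend (s ≤? mid)
    where
    open Recognizable R
    W = image t
    c = i ℕ./ q
    s = i % q

    i≡ : i ≡ c * q + s
    i≡ = m≡[m/n]*n+m%n i q

    -- The first block boundary after `i`. As `q + ℓ ≤ p`, the `ℓ` letters from `x` lie in the first
    -- half of the square and recur at `y`, which `sync` makes a boundary too.
    x = suc c * q
    y = x + p

    i≤x : i ≤ x
    i≤x = ≤-trans (≤-reflexive i≡) (≤-trans (+-monoʳ-≤ (c * q) (<⇒≤ (m%n<n i q))) (≤-reflexive (+-comm (c * q) q)))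

    x+ℓ≤i+p : x + ℓ ≤ i + p
    x+ℓ≤i+p = begin
      q + c * q + ℓ ≤⟨ +-monoˡ-≤ ℓ (+-monoʳ-≤ q (m/n*n≤m i q)) ⟩
      q + i + ℓ     ≡⟨ cong (_+ ℓ) (+-comm q i) ⟩
      i + q + ℓ     ≡⟨ +-assoc i q ℓ ⟩
      i + (q + ℓ)   ≤⟨ +-monoʳ-≤ i q+ℓ≤p ⟩
      i + p         ∎
      where open ≤-Reasoning

    y%q≡0 : y % q ≡ 0
    y%q≡0 = sync (t (y ℕ./ q)) (t (suc (y ℕ./ q))) (t (suc c)) (t≢ _) (m%n<n y q) (begin
      take ℓ (drop (y % q) (blocks (t (y ℕ./ q) ∷ t (suc (y ℕ./ q)) ∷ [])))
        ≡⟨ cong (take ℓ ∘ drop (y % q) ∘ blocks) (factor-pair t (y ℕ./ q)) ⟨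
      take ℓ (drop (y % q) (blocks (factor t (y ℕ./ q) 2)))
        ≡⟨ image-factor t (y ℕ./ q) 2 (m≡[m/n]*n+m%n y q) y%q+ℓ≤2q ⟨
      factor W y ℓ
        ≡⟨ Repeats-sub W rep i≤x x+ℓ≤i+p ⟨
      factor W x ℓ
        ≡⟨ image-factor t (suc c) 1 (sym (+-identityʳ x)) (≤-trans ℓ≤q (≤-reflexive (sym (*-identityˡ q)))) ⟩
      take ℓ (blocks (factor t (suc c) 1))
        ≡⟨ cong (take ℓ ∘ blocks) (factor-suc t (suc c) 0) ⟩
      take ℓ (blocks (t (suc c) ∷ [])) ∎)
      where
      open ≡-Reasoning
      y%q+ℓ≤2q : y % q + ℓ ≤ 2 * q
      y%q+ℓ≤2q = +-mono-≤ (<⇒≤ (m%n<n y q)) (≤-trans ℓ≤q (≤-reflexive (sym (*-identityˡ q))))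

    q∣p : q ∣ p
    q∣p = ∣m+n∣m⇒∣n (divides (y ℕ./ q) (trans (m≡m%n+[m/n]*n y q) (cong (_+ y ℕ./ q * q) y%q≡0))) (divides-refl (suc c))

    m : ℕ
    m = _∣_.quotient q∣p

    p≡ : p ≡ m * q
    p≡ = _∣_.equality q∣p

    -- A determining piece of block `d` inside the first half of the square recurs `p = m * q`
    -- positions later, that is, at the same place in block `d + m`.
    letter : ∀ {d r l} → (∀ b c → take l (drop r (blocks (b ∷ []))) ≡ take l (drop r (blocks (c ∷ []))) → b ≡ c) →
             r + l ≤ q → i ≤ d * q + r → d * q + r + l ≤ i + p → t d ≡ t (d + m)
    letter {d} {r} {l} injective r+l≤q i≤ ≤i+p = injective (t d) (t (d + m)) (begin
      take l (drop r (blocks (t d ∷ [])))           ≡⟨ cong (take l ∘ drop r ∘ blocks) (factor-suc t d 0) ⟨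
      take l (drop r (blocks (factor t d 1)))       ≡⟨ image-factor t d 1 refl r+l≤1q ⟨
      factor W (d * q + r) l                        ≡⟨ Repeats-sub W rep i≤ ≤i+p ⟩
      factor W (d * q + r + p) l                    ≡⟨ image-factor t (d + m) 1 (trans (cong (λ z → d * q + r + z) p≡) (shift d r m q)) r+l≤1q ⟩
      take l (drop r (blocks (factor t (d + m) 1))) ≡⟨ cong (take l ∘ drop r ∘ blocks) (factor-suc t (d + m) 0) ⟩
      take l (drop r (blocks (t (d + m) ∷ [])))     ∎)
      where
      open ≡-Reasoning
      shift : ∀ d r m q → d * q + r + m * q ≡ (d + m) * q + r
      shift = solve-∀
      r+l≤1q : r + l ≤ 1 * q
      r+l≤1q = ≤-trans r+l≤q (≤-reflexive (sym (*-identityˡ q)))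

    repeats : ∀ d → (∀ {j} → j < m → t (d + j) ≡ t (d + j + m)) → Repeats t m d m
    repeats d t≡ = applyUpTo-cong m λ {j} j<m → trans (t≡ j<m) (cong t (+-swapʳ d j m))

    block≤ : ∀ {j} → j < m → suc (c + j) * q ≤ c * q + p
    block≤ {j} j<m = begin
      suc (c + j) * q ≤⟨ *-monoˡ-≤ q (subst (_≤ c + m) (+-suc c j) (+-monoʳ-≤ c j<m)) ⟩
      (c + m) * q     ≡⟨ *-distribʳ-+ q c m ⟩
      c * q + m * q   ≡⟨ cong (λ z → c * q + z) p≡ ⟨
      c * q + p       ∎
      where open ≤-Reasoning

    descend : Dec (s ≤ mid) → ∃[ c ] p ≡ m * q × Repeats t m c m
    descend (yes s≤mid) = c , p≡ , repeats c λ {j} j<m → letter suffix (≤-reflexive (m+[n∸m]≡n mid≤q))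
      (begin
        i                   ≡⟨ i≡ ⟩
        c * q + s           ≤⟨ +-mono-≤ (*-monoˡ-≤ q (m≤m+n c j)) s≤mid ⟩
        (c + j) * q + mid   ∎)
      (begin
        (c + j) * q + mid + (q ∸ mid) ≡⟨ +-assoc ((c + j) * q) mid (q ∸ mid) ⟩
        (c + j) * q + (mid + (q ∸ mid)) ≡⟨ cong (λ z → (c + j) * q + z) (m+[n∸m]≡n mid≤q) ⟩
        (c + j) * q + q     ≡⟨ +-comm ((c + j) * q) q ⟩
        suc (c + j) * q     ≤⟨ block≤ j<m ⟩
        c * q + p           ≤⟨ +-monoˡ-≤ p (m/n*n≤m i q) ⟩
        i + p               ∎)
      where open ≤-Reasoning
    descend (no s≰mid) = suc c , p≡ , repeats (suc c) λ {j} j<m → letter prefix mid≤q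
      (begin
        i                        ≤⟨ i≤x ⟩
        suc c * q                ≤⟨ *-monoˡ-≤ q (m≤m+n (suc c) j) ⟩
        (suc c + j) * q          ≤⟨ m≤m+n _ 0 ⟩
        (suc c + j) * q + 0      ∎)
      (begin
        (suc c + j) * q + 0 + mid ≡⟨ cong (_+ mid) (+-identityʳ _) ⟩
        -- The last prefix ends at `(c + m) * q + mid`; it stays in the first half of the square
        -- because `mid < s`.
        suc (c + j) * q + mid    ≤⟨ +-mono-≤ (block≤ j<m) (≰⇒≥ s≰mid) ⟩
        c * q + p + s            ≡⟨ +-swapʳ (c * q) p s ⟩
        c * q + s + p            ≡⟨ cong (_+ p) i≡ ⟨
        i + p                    ∎)
      where open ≤-Reasoning

  -- A repetition of total length at most `3 * q` lies in the block where it starts and the next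
  -- three. Hence it suffices to test the `q` starting positions in the first block of each image of
  -- an admissible word.
  BlocksAvoid : DecidableEquality A → (ℕ → ℕ) → ℕ → Set
  BlocksAvoid _≟A_ l P =
    (∀ {p} → p < P → q + (suc p + l (suc p)) ≤ 4 * q) ×
    (∀ b c d e → let u = b ∷ c ∷ d ∷ e ∷ [] in Admissible u → T (tailsAvoid _≟A_ l P q (blocks u)))

  blocksAvoid? : ∀ (_≟A_ : DecidableEquality A) l P → Dec (BlocksAvoid _≟A_ l P)
  blocksAvoid? _≟A_ l P =
    allUpTo? (λ p → q + (suc p + l (suc p)) ≤? 4 * q) P ×-dec
    (all? λ b → all? λ c → all? λ d → all? λ e → admissible? (b ∷ c ∷ d ∷ e ∷ []) →-dec T? _)

  ¬Repeats-small : ∀ t l {P} {_≟A_ : DecidableEquality A} → BlocksAvoid _≟A_ l P → SquareFreeUpTo 2 t → ∀ {p} → p < P → ∀ i →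
                   ¬ Repeats (image t) (suc p) i (l (suc p))
  ¬Repeats-small t l {P} {_≟A_} (fits , avoids) sf {p} p<P i rep =
    Avoids⇒¬Repeats (image t) l (c * q) (i % q) (4 * q) (image-blocks t c 4) (tailsAvoid-sound _≟A_ l P q _ (avoids _ _ _ _ (factor-admissible t sf c)) (m%n<n i q)) p<P
      (≤-trans (+-monoˡ-≤ _ (<⇒≤ (m%n<n i q))) (fits p<P))
      (subst (λ i → Repeats (image t) (suc p) i (l (suc p))) (m≡[m/n]*n+m%n i q) rep)
    where c = i ℕ./ q

  ¬Repeats-large : ∀ t {ℓ mid p} → Recognizable ℓ mid → SquareFree t → q + ℓ ≤ suc p → ∀ i →
                   ¬ Repeats (image t) (suc p) i (suc p)
  ¬Repeats-large t R sf q+ℓ≤p i rep =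
    descended (square-descent t R (λ n → sf 0 n ∘ ≡⇒Repeats t n) q+ℓ≤p rep)
    where
    descended : ∀ {p} → ∃[ m ] ∃[ c ] suc p ≡ m * q × Repeats t m c m → ⊥
    -- The quotient cannot be zero because the period is positive, so the repetition in `t` is a
    -- genuine square.
    descended (suc m , c , _ , rep′) = sf m c rep′

-- The squarefree ternary word.

leech : Fin 3 → Vec (Fin 3) 13
leech 0F =
  0F ∷ 1F ∷ 2F ∷ 1F ∷ 0F ∷ 2F ∷ 1F ∷ 2F ∷ 0F ∷ 1F ∷ 2F ∷ 1F ∷ 0F ∷ []
leech 1F =
  1F ∷ 2F ∷ 0F ∷ 2F ∷ 1F ∷ 0F ∷ 2F ∷ 0F ∷ 1F ∷ 2F ∷ 0F ∷ 2F ∷ 1F ∷ []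
leech 2F =
  2F ∷ 0F ∷ 1F ∷ 0F ∷ 2F ∷ 1F ∷ 0F ∷ 1F ∷ 2F ∷ 0F ∷ 1F ∷ 0F ∷ 2F ∷ []

leechIterate : ℕ → InfiniteWord (Fin 3)
leechIterate zero    n = 0F
leechIterate (suc k) = image leech (leechIterate k)

-- The fixed point as a diagonal: the letter at position `n` is settled after `n` iterations.
ternary : InfiniteWord (Fin 3)
ternary n = leechIterate n n

n/13≤ : ∀ {n k} → n ≤ suc k → n ℕ./ 13 ≤ k
n/13≤ {zero}  _   = z≤n
n/13≤ {suc n} n≤k = s≤s⁻¹ (<-≤-trans (m/n<m (suc n) 13 (s≤s (s≤s z≤n))) n≤k)

opaque
  unfolding image

  -- Each iteration replaces position `n` by `n / 13`, which is smaller unless `n = 0`. At position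
  -- 0 all iterates agree, because `leech 0F` begins with `0F`.
  leechIterate-stable : ∀ j k {n} → n ≤ j → n ≤ k → leechIterate j n ≡ leechIterate k n
  leechIterate-stable zero    zero    _   _   = refl
  leechIterate-stable zero    (suc k) z≤n _   = cong (λ c → Vec.lookup (leech c) 0F) (leechIterate-stable zero k {0} z≤n z≤n)
  leechIterate-stable (suc j) zero    _   z≤n = cong (λ c → Vec.lookup (leech c) 0F) (leechIterate-stable j zero {0} z≤n z≤n)
  leechIterate-stable (suc j) (suc k) {n} n≤j n≤k =
    cong (λ c → Vec.lookup (leech c) (n mod 13)) (leechIterate-stable j k (n/13≤ n≤j) (n/13≤ n≤k))

  ternary-fixed : ∀ n → ternary n ≡ image leech ternary n
  ternary-fixed zero    = refl
  ternary-fixed (suc n) = cong (λ c → Vec.lookup (leech c) (suc n mod 13))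
    (leechIterate-stable n (suc n ℕ./ 13) (n/13≤ ≤-refl) ≤-refl)

opaque
  unfolding image

  ternary-0≢1 : ternary 0 ≢ ternary 1
  ternary-0≢1 ()

leech-recognizable : Recognizable leech 7 1
leech-recognizable = toWitness {a? = recognizable? leech _≟_ 7 1} _

-- The periods up to 19 are tested; from `13 + 7 = 20` on, `square-descent` applies with the
-- constants of `leech-recognizable`.
leech-blocksAvoid : BlocksAvoid leech _≟_ id 19
leech-blocksAvoid = toWitness {a? = blocksAvoid? leech _≟_ id 19} _

leech-pairsAvoid : ∀ b c → b ≢ c → ∀ {r} → r < 13 → Avoids id 2 (drop r (blocks leech (b ∷ c ∷ [])))
leech-pairsAvoid = toWitness {a? = all? λ b → all? λ c → ¬? (b ≟ c) →-dec allUpTo? (λ r → avoids? _≟_ id 2 _) 13} _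

-- Induction on the position: a square of period 1 or 2 at `i` lies in the images of the letters at
-- `c = i / 13` and `c + 1`. Once these are known to differ, `leech-pairsAvoid` excludes it.
ternary-squareFreeUpTo2 : SquareFreeUpTo 2 ternary
ternary-squareFreeUpTo2 p<2 i = <-rec (λ i → ∀ {p} → p < 2 → ¬ Repeats ternary (suc p) i (suc p)) step i p<2
  where
  distinct : ∀ c → (c ≢ 0 → ¬ Repeats ternary 1 c 1) → ternary c ≢ ternary (suc c)
  -- At `c = 0` the position need not have decreased, so the first two letters are compared by
  -- evaluation.
  distinct zero    _  = ternary-0≢1
  distinct (suc c) ih = ih (λ ()) ∘ ≡⇒Repeats ternary (suc c)

  step : ∀ i → (∀ {k} → k < i → ∀ {p} → p < 2 → ¬ Repeats ternary (suc p) k (suc p)) →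
         ∀ {p} → p < 2 → ¬ Repeats ternary (suc p) i (suc p)
  step i ih {p} p<2 rep =
    Avoids⇒¬Repeats (image leech ternary) id (c * 13) (i % 13) 26 window (leech-pairsAvoid _ _ c≢ (m%n<n i 13)) p<2
      (+-mono-≤ (<⇒≤ (m%n<n i 13)) (≤-trans (+-mono-≤ p<2 p<2) (m≤m+n 4 9)))
      (subst (λ i → Repeats (image leech ternary) (suc p) i (suc p)) (m≡[m/n]*n+m%n i 13)
        (Repeats-cong ternary (image leech ternary) i i (λ j → ternary-fixed (i + j)) rep))
    where
    c = i ℕ./ 13
    c≢ : ternary c ≢ ternary (suc c)
    c≢ = distinct c λ c≢0 → ih (m/n<m i 13 ⦃ ≢-nonZero (c≢0 ∘ cong (ℕ._/ 13)) ⦄ (s≤s (s≤s z≤n))) (s≤s z≤n)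
    window : factor (image leech ternary) (c * 13) 26 ≡ blocks leech (ternary c ∷ ternary (suc c) ∷ [])
    window = trans (image-blocks leech ternary c 2) (cong (blocks leech) (factor-pair ternary c))

ternary-≢ : ∀ n → ternary n ≢ ternary (suc n)
ternary-≢ = λ n → ternary-squareFreeUpTo2 (s≤s z≤n) n ∘ ≡⇒Repeats ternary n

-- Induction on the period: a long square has period `m * 13` and descends to one of period `m` in
-- the same word, as `ternary` is its own image.
ternary-squareFree : SquareFree ternary
ternary-squareFree = <-rec (λ p → ∀ i → ¬ Repeats ternary (suc p) i (suc p)) step
  where
  step : ∀ p → (∀ {k} → k < p → ∀ i → ¬ Repeats ternary (suc k) i (suc k)) → ∀ i → ¬ Repeats ternary (suc p) i (suc p)
  step p ih i rep = either (p <? 19)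
    where
    rep′ : Repeats (image leech ternary) (suc p) i (suc p)
    rep′ = Repeats-cong ternary (image leech ternary) i i (λ j → ternary-fixed (i + j)) rep

    descended : ∃[ m ] ∃[ c ] suc p ≡ m * 13 × Repeats ternary m c m → ⊥
    descended (suc m , c , refl , rep″) = ih (s≤s (≤-trans (m≤m*n m 13) (m≤n+m (m * 13) 11))) c rep″

    either : Dec (p < 19) → ⊥
    either (yes p<19) = ¬Repeats-small leech ternary id leech-blocksAvoid ternary-squareFreeUpTo2 p<19 i rep′
    either (no p≮19)  = descended (square-descent leech ternary leech-recognizable ternary-≢ (s≤s (≮⇒≥ p≮19)) rep′)

-- The binary word and its squares.

binary : Fin 3 → Vec (Fin 2) 49
binary 0F =
  1F ∷ 1F ∷ 0F ∷ 0F ∷ 1F ∷ 0F ∷ 1F ∷ 0F ∷ 0F ∷ 1F ∷ 1F ∷ 0F ∷ 1F ∷ 1F ∷ 0F ∷ 0F ∷ 1F ∷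
  0F ∷ 0F ∷ 1F ∷ 1F ∷ 0F ∷ 1F ∷ 0F ∷ 0F ∷ 1F ∷ 0F ∷ 1F ∷ 1F ∷ 0F ∷ 0F ∷ 1F ∷ 0F ∷ 0F ∷
  1F ∷ 1F ∷ 0F ∷ 1F ∷ 1F ∷ 0F ∷ 0F ∷ 1F ∷ 0F ∷ 1F ∷ 1F ∷ 0F ∷ 1F ∷ 0F ∷ 0F ∷ []
binary 1F =
  1F ∷ 1F ∷ 0F ∷ 0F ∷ 1F ∷ 0F ∷ 1F ∷ 0F ∷ 0F ∷ 1F ∷ 1F ∷ 0F ∷ 1F ∷ 0F ∷ 1F ∷ 1F ∷ 0F ∷
  1F ∷ 0F ∷ 0F ∷ 1F ∷ 1F ∷ 0F ∷ 1F ∷ 1F ∷ 0F ∷ 0F ∷ 1F ∷ 0F ∷ 1F ∷ 0F ∷ 0F ∷ 1F ∷ 0F ∷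
  1F ∷ 1F ∷ 0F ∷ 0F ∷ 1F ∷ 1F ∷ 0F ∷ 1F ∷ 0F ∷ 1F ∷ 1F ∷ 0F ∷ 1F ∷ 0F ∷ 0F ∷ []
binary 2F =
  1F ∷ 1F ∷ 0F ∷ 0F ∷ 1F ∷ 0F ∷ 1F ∷ 0F ∷ 0F ∷ 1F ∷ 0F ∷ 1F ∷ 1F ∷ 0F ∷ 0F ∷ 1F ∷ 0F ∷
  0F ∷ 1F ∷ 1F ∷ 0F ∷ 1F ∷ 0F ∷ 1F ∷ 1F ∷ 0F ∷ 0F ∷ 1F ∷ 0F ∷ 1F ∷ 0F ∷ 0F ∷ 1F ∷ 0F ∷
  1F ∷ 1F ∷ 0F ∷ 0F ∷ 1F ∷ 1F ∷ 0F ∷ 1F ∷ 0F ∷ 1F ∷ 1F ∷ 0F ∷ 1F ∷ 0F ∷ 0F ∷ []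

-- The blocks of `0F` and `1F` first differ at index 13, those of `1F` and `2F` last differ at index
-- 20. A cut at 18 therefore leaves a difference on both sides.
binary-recognizable : Recognizable binary 17 18
binary-recognizable = toWitness {a? = recognizable? binary _≟_ 17 18} _

-- Five is the largest period of a square in the binary word.
binaryLimit : ℕ → ℕ
binaryLimit p = if p ≤ᵇ 5 then suc (3 * p ℕ./ 2) else p

-- The descent takes over at period `49 + 17 = 66`.
binary-blocksAvoid : BlocksAvoid binary _≟_ binaryLimit 65
binary-blocksAvoid = toWitness {a? = blocksAvoid? binary _≟_ binaryLimit 65} _

binaryWord : InfiniteWord (Fin 2)
binaryWord = image binary ternary

binary-¬Repeats-small : ∀ {p} → p < 65 → ∀ i → ¬ Repeats binaryWord (suc p) i (binaryLimit (suc p))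
binary-¬Repeats-small = ¬Repeats-small binary ternary binaryLimit binary-blocksAvoid ternary-squareFreeUpTo2

binary-square-period : ∀ p i → Repeats binaryWord (suc p) i (suc p) → p < 5
binary-square-period 0 i rep = s≤s z≤n
binary-square-period 1 i rep = s≤s (s≤s z≤n)
binary-square-period 2 i rep = s≤s (s≤s (s≤s z≤n))
binary-square-period 3 i rep = s≤s (s≤s (s≤s (s≤s z≤n)))
binary-square-period 4 i rep = s≤s (s≤s (s≤s (s≤s (s≤s z≤n))))
-- Five visible successors let `binaryLimit (suc p)` evaluate to `suc p`, so the finite test
-- excludes plain squares here.
binary-square-period p@(suc (suc (suc (suc (suc _))))) i rep = contradiction rep (either (p <? 65))
  where
  either : Dec (p < 65) → ¬ Repeats binaryWord (suc p) i (suc p)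
  either (yes p<65) = binary-¬Repeats-small p<65 i
  either (no p≮65)  = ¬Repeats-large binary ternary binary-recognizable ternary-squareFree (s≤s (≮⇒≥ p≮65)) i

-- An overlap above `3/2` of the period, that is, an exponent above `5/2`, contains a square of the
-- same period. This leaves periods up to 5, where `binaryLimit` tests exactly this overlap.
binary-¬Repeats : ∀ p i → ¬ Repeats binaryWord (suc p) i (suc (3 * suc p ℕ./ 2))
binary-¬Repeats p i rep = short p (binary-square-period p i (Repeats-prefix binaryWord rep (≤-trans p≤ (n≤1+n _)))) rep
  where
  p≤ : suc p ≤ 3 * suc p ℕ./ 2
  p≤ = ≤-trans (≤-reflexive (sym (m*n/n≡m (suc p) 2)))
    (/-monoˡ-≤ 2 (≤-trans (≤-reflexive (*-comm (suc p) 2)) (*-monoˡ-≤ (suc p) {2} {3} (n≤1+n 2))))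

  small : ∀ {p} → p < 5 → ¬ Repeats binaryWord (suc p) i (binaryLimit (suc p))
  small p<5 = binary-¬Repeats-small (≤-trans p<5 (m≤m+n 5 60)) i

  short : ∀ p → p < 5 → ¬ Repeats binaryWord (suc p) i (suc (3 * suc p ℕ./ 2))
  short 0 p<5 = small p<5
  short 1 p<5 = small p<5
  short 2 p<5 = small p<5
  short 3 p<5 = small p<5
  short 4 p<5 = small p<5
  short (suc (suc (suc (suc (suc _))))) (s≤s (s≤s (s≤s (s≤s (s≤s ())))))

-- Curling numbers of prefixes of the binary word.

module _ (w : InfiniteWord A) where

  Repeats⇒EndsInPower : ∀ {p i n} → i + (suc p + suc p) ≡ n → Repeats w (suc p) i (suc p) → EndsInPower (factor w 0 n) 2
  Repeats⇒EndsInPower {p} {i} refl rep = factor w 0 i , factor w i (suc p) , (λ ()) , (begin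
    factor w 0 (i + (suc p + suc p))
      ≡⟨ factor-++ w 0 i (suc p + suc p) ⟩
    factor w 0 i ++ factor w i (suc p + suc p)
      ≡⟨ cong (λ z → factor w 0 i ++ z) (factor-++ w i (suc p) (suc p)) ⟩
    factor w 0 i ++ factor w i (suc p) ++ factor w (i + suc p) (suc p)
      ≡⟨ cong (λ z → factor w 0 i ++ factor w i (suc p) ++ z) rep ⟨
    factor w 0 i ++ factor w i (suc p) ++ factor w i (suc p)
      ≡⟨ cong (λ z → factor w 0 i ++ factor w i (suc p) ++ z) (++-identityʳ (factor w i (suc p))) ⟨
    factor w 0 i ++ factor w i (suc p) ^ 2 ∎)
    where open ≡-Reasoning

  square⇒Repeats : ∀ {n} y {z} → factor w 0 n ≡ y ++ z ^ 2 → length y + (length z + length z) ≡ n × Repeats w (length z) (length y) (length z)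
  square⇒Repeats {n} y {z} eq = lengths , trans (sym (proj₁ zz)) (trans (sym (++-identityʳ z)) (trans (proj₂ zz) (cong (factor w _) (cong length (++-identityʳ z)))))
    where
    lengths : length y + (length z + length z) ≡ n
    lengths = begin
      length y + (length z + length z)             ≡⟨ cong (λ k → length y + (length z + length k)) (++-identityʳ z) ⟨
      length y + (length z + length (z ++ []))     ≡⟨ cong (λ k → length y + k) (length-++ z) ⟨
      length y + length (z ^ 2)                    ≡⟨ length-++ y ⟨
      length (y ++ z ^ 2)                          ≡⟨ cong length eq ⟨
      length (factor w 0 n)                        ≡⟨ length-applyUpTo w n ⟩
      n                                            ∎
      where open ≡-Reasoning
    zz : z ≡ factor w (length y) (length z) × z ++ [] ≡ factor w (length y + length z) (length (z ++ []))
    zz = factor-++⁻ w (length y) z (sym (proj₂ (factor-++⁻ w 0 y eq)))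

  -- The first three copies of `z` after `y` already form a block of length `3 * p` with period `p`.
  cube⇒Repeats : ∀ {n} k y {z} → factor w 0 n ≡ y ++ z ^ (3 + k) → Repeats w (length z) (length y) (length z + length z)
  cube⇒Repeats k y {z} eq = begin
    factor w i (p + p)                               ≡⟨ factor-++ w i p p ⟩
    factor w i p ++ factor w (i + p) p               ≡⟨ cong₂ _++_ (proj₁ first) (proj₁ second) ⟨
    z ++ z                                           ≡⟨ cong₂ _++_ (proj₁ second) (proj₁ third) ⟩
    factor w (i + p) p ++ factor w (i + p + p) p     ≡⟨ factor-++ w (i + p) p p ⟨
    factor w (i + p) (p + p)                         ∎
    where
    open ≡-Reasoning
    i = length y
    p = length z
    first  = factor-++⁻ w i z {z ^ (2 + k)} (sym (proj₂ (factor-++⁻ w 0 y eq)))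
    second = factor-++⁻ w (i + p) z {z ^ (1 + k)} (sym (proj₂ first))
    third  = factor-++⁻ w (i + p + p) z {z ^ k} (sym (proj₂ second))

-- Squares of the binary word have period at most 5, hence the p < 5 below.
SquareSuffix : List (Fin 2) → ℕ → ℕ → Set
SquareSuffix x e p = suc p + suc p ≤ e × take (suc p) (drop (e ∸ (suc p + suc p)) x) ≡ take (suc p) (drop (e ∸ suc p) x)

squareSuffix? : ∀ x e → Dec (∃[ p ] p < 5 × SquareSuffix x e p)
squareSuffix? x e = anyUpTo? (λ p → suc p + suc p ≤? e ×-dec ≡-dec _≟_ _ _) 5

opaque
  -- Two values suffice for the binary word, since a cube has exponent above `5/2`.
  windowCurling : List (Fin 2) → ℕ → ℕ
  windowCurling x e = if does (squareSuffix? x e) then 2 else 1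

  windowCurling-elim : ∀ {x e} (Q : ℕ → Set) → (∃[ p ] p < 5 × SquareSuffix x e p → Q 2) →
                  (¬ (∃[ p ] p < 5 × SquareSuffix x e p) → Q 1) → Q (windowCurling x e)
  windowCurling-elim {x} {e} Q q₂ q₁ with squareSuffix? x e
  ... | yes square = q₂ square
  ... | no ¬square = q₁ ¬square

-- A square suffix has length at most `2 * 5 = 10`, so it is visible in a window that shows ten
-- letters up to the position, or that starts at the beginning of the word.
C-local : ∀ s e {n} → suc e ≤ n → s ≡ 0 ⊎ 10 ≤ suc e →
          C _≟_ binaryWord (s + e) ≡ windowCurling (factor binaryWord s n) (suc e)
C-local s e {n} e<n far = IsCurlingNumber-unique (curlingNumber-correct _≟_ u _)
  (windowCurling-elim (IsCurlingNumber u) two one)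
  where
  u = factor binaryWord 0 (suc (s + e))

  ¬cube : ∀ k y z → z ≢ [] → u ≢ y ++ z ^ (3 + k)
  ¬cube k y []       z≢[] _  = z≢[] refl
  -- A cube overlaps its shift in two full periods, more than the `3/2` that `binary-¬Repeats`
  -- excludes.
  ¬cube k y z@(_ ∷ zs) _  eq = binary-¬Repeats (length zs) (length y)
    (Repeats-prefix binaryWord (cube⇒Repeats binaryWord k y {z} eq) (3p/2< (length zs)))
    where
    3p/2< : ∀ p → 3 * suc p ℕ./ 2 < suc p + suc p
    3p/2< p = m<n*o⇒m/o<n {3 * suc p} (≤-trans (m≤m+n _ p) (≤-reflexive (lemma p)))
      where
      lemma : ∀ p → suc (3 * suc p) + p ≡ (suc p + suc p) * 2
      lemma = solve-∀

  bound₂ : ∀ j → 1 ≤ j → EndsInPower u j → j ≤ 2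
  bound₂ 1 _ _ = s≤s z≤n
  bound₂ 2 _ _ = s≤s (s≤s z≤n)
  bound₂ (suc (suc (suc j))) _ (y , z , z≢[] , eq) = contradiction eq (¬cube j y z z≢[])

  window : ∀ {p d} → suc e ≡ d + (suc p + suc p) →
           take (suc p) (drop d (factor binaryWord s n)) ≡ factor binaryWord (s + d) (suc p) ×
           take (suc p) (drop (d + suc p) (factor binaryWord s n)) ≡ factor binaryWord (s + d + suc p) (suc p)
  window {p} {d} e≡ =
    take-drop-factor binaryWord s d (≤-trans (+-monoʳ-≤ d (m≤m+n (suc p) (suc p))) bound) ,
    trans (take-drop-factor binaryWord s (d + suc p) (≤-trans (≤-reflexive (+-assoc d (suc p) (suc p))) bound))
          (cong (λ i → factor binaryWord i (suc p)) (sym (+-assoc s d (suc p))))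
    where
    bound : d + (suc p + suc p) ≤ n
    bound = ≤-trans (≤-reflexive (sym e≡)) e<n

  ∸-half : ∀ {p d} → suc e ≡ d + (suc p + suc p) → suc e ∸ suc p ≡ d + suc p
  ∸-half {p} {d} e≡ = trans (cong (_∸ suc p) (trans e≡ (sym (+-assoc d (suc p) (suc p))))) (m+n∸n≡m (d + suc p) (suc p))

  two : ∃[ p ] p < 5 × SquareSuffix (factor binaryWord s n) (suc e) p → IsCurlingNumber u 2
  two (p , _ , 2p≤e , eq) = record
    { 1≤k = s≤s z≤n
    ; power = Repeats⇒EndsInPower binaryWord {i = s + d} ends
        (trans (sym (proj₁ (window {p} e≡))) (trans eq (trans (cong (λ r → take (suc p) (drop r (factor binaryWord s n))) (∸-half {p} e≡)) (proj₂ (window {p} e≡)))))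
    ; largest = bound₂ }
    where
    d = suc e ∸ (suc p + suc p)
    e≡ : suc e ≡ d + (suc p + suc p)
    e≡ = sym (m∸n+n≡m 2p≤e)
    ends : s + d + (suc p + suc p) ≡ suc (s + e)
    ends = trans (+-assoc s d (suc p + suc p)) (trans (cong (λ k → s + k) (sym e≡)) (+-suc s e))

  one : ¬ (∃[ p ] p < 5 × SquareSuffix (factor binaryWord s n) (suc e) p) → IsCurlingNumber u 1
  one ¬square = record { 1≤k = s≤s z≤n ; power = [] , u , (λ ()) , sym (++-identityʳ u) ; largest = bound₁ }
    where
    ¬square′ : ∀ y z → z ≢ [] → u ≢ y ++ z ^ 2
    ¬square′ y []       z≢[] _ = z≢[] refl
    ¬square′ y z@(_ ∷ zs) _  eq = ¬square (p , p<5 , 2p≤e far ,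
      trans (proj₁ (window {p} e≡)) (trans (subst (λ i → Repeats binaryWord (suc p) i (suc p)) y≡ rep)
        (trans (sym (proj₂ (window {p} e≡))) (cong (λ r → take (suc p) (drop r (factor binaryWord s n))) (sym (∸-half {p} e≡))))))
      where
      p = length zs
      d = suc e ∸ (suc p + suc p)
      ends : length y + (suc p + suc p) ≡ suc (s + e)
      ends = proj₁ (square⇒Repeats binaryWord y {z} eq)
      rep : Repeats binaryWord (suc p) (length y) (suc p)
      rep = proj₂ (square⇒Repeats binaryWord y {z} eq)
      p<5 : p < 5
      p<5 = binary-square-period p (length y) rep
      2p≤e : s ≡ 0 ⊎ 10 ≤ suc e → suc p + suc p ≤ suc e
      2p≤e (inj₁ refl) = ≤-trans (m≤n+m (suc p + suc p) (length y)) (≤-reflexive ends)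
      2p≤e (inj₂ 10≤e) = ≤-trans (+-mono-≤ p<5 p<5) 10≤e
      e≡ : suc e ≡ d + (suc p + suc p)
      e≡ = sym (m∸n+n≡m (2p≤e far))
      y≡ : length y ≡ s + d
      y≡ = +-cancelʳ-≡ (suc p + suc p) (length y) (s + d)
        (trans ends (trans (sym (+-suc s e)) (trans (cong (λ k → s + k) e≡) (sym (+-assoc s d (suc p + suc p))))))

    bound₁ : ∀ j → 1 ≤ j → EndsInPower u j → j ≤ 1
    bound₁ 1 _ _ = s≤s z≤n
    bound₁ 2 _ (y , z , z≢[] , eq) = contradiction eq (¬square′ y z z≢[])
    bound₁ (suc (suc (suc j))) _ (y , z , z≢[] , eq) = contradiction eq (¬cube j y z z≢[])

-- The curling-number transform as a uniform image.

curlingBlock : Fin 3 → Vec ℕ 49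
curlingBlock 0F =
  1 ∷ 2 ∷ 1 ∷ 2 ∷ 2 ∷ 1 ∷ 2 ∷ 2 ∷ 2 ∷ 1 ∷ 2 ∷ 1 ∷ 1 ∷ 2 ∷ 2 ∷ 2 ∷ 1 ∷ 1 ∷ 2 ∷ 2 ∷ 2 ∷ 1 ∷ 1 ∷ 2 ∷ 2 ∷
  1 ∷ 2 ∷ 2 ∷ 2 ∷ 1 ∷ 2 ∷ 1 ∷ 1 ∷ 2 ∷ 2 ∷ 2 ∷ 1 ∷ 1 ∷ 2 ∷ 2 ∷ 2 ∷ 1 ∷ 1 ∷ 2 ∷ 2 ∷ 1 ∷ 2 ∷ 2 ∷ 2 ∷ []
curlingBlock 1F =
  1 ∷ 2 ∷ 1 ∷ 2 ∷ 2 ∷ 1 ∷ 2 ∷ 2 ∷ 2 ∷ 1 ∷ 2 ∷ 1 ∷ 1 ∷ 2 ∷ 2 ∷ 2 ∷ 1 ∷ 2 ∷ 2 ∷ 2 ∷ 1 ∷ 2 ∷ 1 ∷ 1 ∷ 2 ∷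
  2 ∷ 2 ∷ 1 ∷ 1 ∷ 2 ∷ 2 ∷ 2 ∷ 1 ∷ 2 ∷ 2 ∷ 2 ∷ 1 ∷ 2 ∷ 1 ∷ 2 ∷ 2 ∷ 1 ∷ 2 ∷ 2 ∷ 2 ∷ 1 ∷ 2 ∷ 2 ∷ 2 ∷ []
curlingBlock 2F =
  1 ∷ 2 ∷ 1 ∷ 2 ∷ 2 ∷ 1 ∷ 2 ∷ 2 ∷ 2 ∷ 1 ∷ 2 ∷ 2 ∷ 2 ∷ 1 ∷ 2 ∷ 1 ∷ 1 ∷ 2 ∷ 2 ∷ 2 ∷ 1 ∷ 1 ∷ 2 ∷ 2 ∷ 2 ∷
  1 ∷ 2 ∷ 1 ∷ 1 ∷ 2 ∷ 2 ∷ 2 ∷ 1 ∷ 2 ∷ 2 ∷ 2 ∷ 1 ∷ 2 ∷ 1 ∷ 2 ∷ 2 ∷ 1 ∷ 2 ∷ 2 ∷ 2 ∷ 1 ∷ 2 ∷ 2 ∷ 2 ∷ []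

opaque
  unfolding windowCurling

  -- The result is independent of `b`: a square suffix reaches back at most nine letters before the
  -- current one, and the three binary blocks share their last nine letters.
  curlingBlock-correct : ∀ b c → b ≢ c → ∀ r →
    windowCurling (blocks binary (b ∷ c ∷ [])) (suc (49 + toℕ r)) ≡ Vec.lookup (curlingBlock c) r
  curlingBlock-correct = toWitness {a? = all? λ b → all? λ c → ¬? (b ≟ c) →-dec all? λ r → _ ℕ.≟ _} _

-- The blocks of `0F` and `1F` agree up to index 16, so 18 is the smallest cut that tells them apart
-- by their prefixes.
curling-recognizable : Recognizable curlingBlock 17 18
curling-recognizable = toWitness {a? = recognizable? curlingBlock ℕ._≟_ 17 18} _

-- Twenty is the largest period of a square in the image of the ternary word under curlingBlock.
curlingLimit : ℕ → ℕ
curlingLimit p = if p ≤ᵇ 20 then suc (2 * p) else p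

curlingLimit≤ : ∀ p → curlingLimit p ≤ suc (2 * p)
curlingLimit≤ p = if≤ (p ≤ᵇ 20)
  where
  if≤ : ∀ b → (if b then suc (2 * p) else p) ≤ suc (2 * p)
  if≤ true  = ≤-refl
  if≤ false = ≤-trans (m≤m+n p (p + 0)) (n≤1+n _)

curling-blocksAvoid : BlocksAvoid curlingBlock ℕ._≟_ curlingLimit 65
curling-blocksAvoid = toWitness {a? = blocksAvoid? curlingBlock ℕ._≟_ curlingLimit 65} _

-- The first 49 letters of C(w) are not a block: a square cannot reach to the left of position 0.
curlingPrefix : ℕ → List ℕ
curlingPrefix = applyUpTo λ e → windowCurling (blocks binary (0F ∷ 1F ∷ 2F ∷ 1F ∷ [])) (suc e)

opaque
  unfolding windowCurling

  -- Covers the repetitions that start in the irregular first 49 letters. Those tested have total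
  -- length at most `3 * 49` and so end within 196 letters.
  curlingPrefix-avoids : T (tailsAvoid ℕ._≟_ curlingLimit 65 49 (curlingPrefix 196))
  curlingPrefix-avoids = _

opaque
  unfolding image

  ternary-prefix : factor ternary 0 4 ≡ 0F ∷ 1F ∷ 2F ∷ 1F ∷ []
  ternary-prefix = refl

C-prefix : ∀ n → n ≤ 196 → factor (C _≟_ binaryWord) 0 n ≡ curlingPrefix n
C-prefix n n≤196 = applyUpTo-cong n λ {e} e<n → trans (C-local 0 e (≤-trans e<n n≤196) (inj₁ refl))
  (cong (λ x → windowCurling x (suc e)) prefix)
  where
  prefix : factor binaryWord 0 196 ≡ blocks binary (0F ∷ 1F ∷ 2F ∷ 1F ∷ [])
  prefix = trans (image-blocks binary ternary 0 4) (cong (blocks binary) ternary-prefix)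

C-block : ∀ c r → C _≟_ binaryWord (c * 49 + (49 + toℕ r)) ≡ Vec.lookup (curlingBlock (ternary (suc c))) r
C-block c r = begin
  C _≟_ binaryWord (c * 49 + (49 + toℕ r))
    -- The window starts one block before the one considered, so it shows at least 50 letters up to
    -- the position.
    ≡⟨ C-local (c * 49) (49 + toℕ r) {2 * 49} (+-monoʳ-≤ 49 (toℕ<n r)) (inj₂ (m≤m+n 10 _)) ⟩
  windowCurling (factor binaryWord (c * 49) (2 * 49)) (suc (49 + toℕ r))
    ≡⟨ cong (λ x → windowCurling x (suc (49 + toℕ r))) window ⟩
  windowCurling (blocks binary (ternary c ∷ ternary (suc c) ∷ [])) (suc (49 + toℕ r))
    ≡⟨ curlingBlock-correct _ _ (ternary-≢ c) r ⟩
  Vec.lookup (curlingBlock (ternary (suc c))) r ∎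
  where
  open ≡-Reasoning
  window : factor binaryWord (c * 49) (2 * 49) ≡ blocks binary (ternary c ∷ ternary (suc c) ∷ [])
  window = trans (image-blocks binary ternary c 2) (cong (blocks binary) (factor-pair ternary c))

-- `v` stands for `C(w)`, which enters the argument only through its prefix and its later blocks.
module _ (v : InfiniteWord ℕ) (c-prefix : ∀ n → n ≤ 196 → factor v 0 n ≡ curlingPrefix n)
         (c-block : ∀ c r → v (c * 49 + (49 + toℕ r)) ≡ Vec.lookup (curlingBlock (ternary (suc c))) r) where

  private
    -- Removing the irregular first block of 49 letters removes the first letter of `ternary`, hence
    -- the `suc`.
    curlings : InfiniteWord ℕ
    curlings = image curlingBlock (ternary ∘ suc)

  c-image : ∀ n → v (49 + n) ≡ curlings n
  c-image n = begin
    v (49 + n)                       ≡⟨ cong v (trans (cong (λ k → 49 + k) n≡) (swap 49 (c * 49) (toℕ r))) ⟩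
    v (c * 49 + (49 + toℕ r))        ≡⟨ c-block c r ⟩
    Vec.lookup (curlingBlock (ternary (suc c))) r ≡⟨ image-lookup curlingBlock (ternary ∘ suc) c r ⟨
    curlings (c * 49 + toℕ r)        ≡⟨ cong curlings n≡ ⟨
    curlings n                       ∎
    where
    open ≡-Reasoning
    c = n ℕ./ 49
    r = n mod 49
    n≡ : n ≡ c * 49 + toℕ r
    n≡ = trans (m≡[m/n]*n+m%n n 49) (cong (λ k → c * 49 + k) (sym (toℕ-fromℕ< (m%n<n n 49))))
    swap : ∀ x y z → x + (y + z) ≡ y + (x + z)
    swap = solve-∀

  curling-¬Repeats : ∀ p i → ¬ Repeats v (suc p) i (suc (2 * suc p))
  curling-¬Repeats p i rep = either (p <? 65)
    where
    shifted : ∀ {l} k → Repeats v (suc p) (49 + k) l → Repeats curlings (suc p) k l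
    shifted k = Repeats-cong v curlings (49 + k) k (λ j → c-image (k + j))

    small : p < 65 → Dec (i < 49) → ∀ k → (49 ≤ i → i ≡ 49 + k) → Repeats v (suc p) i (curlingLimit (suc p)) → ⊥
    small p<65 (yes i<49) _ _ =
      Avoids⇒¬Repeats v curlingLimit 0 i 196 (c-prefix 196 ≤-refl)
        (tailsAvoid-sound ℕ._≟_ curlingLimit 65 49 (curlingPrefix 196) curlingPrefix-avoids i<49) p<65
        (≤-trans (+-monoˡ-≤ _ (<⇒≤ i<49)) (proj₁ curling-blocksAvoid p<65))
    small p<65 (no i≮49) k i≡ rep′ =
      ¬Repeats-small curlingBlock (ternary ∘ suc) curlingLimit curling-blocksAvoid
        (λ p<2 → ternary-squareFreeUpTo2 p<2 ∘ suc) p<65 k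
        (shifted k (subst (λ i → Repeats v (suc p) i (curlingLimit (suc p))) (i≡ (≮⇒≥ i≮49)) rep′))

    either : Dec (p < 65) → ⊥
    either (yes p<65) = small p<65 (i <? 49) (i ∸ 49) (sym ∘ m+[n∸m]≡n)
      (Repeats-prefix v rep (curlingLimit≤ (suc p)))
    -- Dropping the first 49 letters of the repetition moves it into the image. The overlap of more
    -- than two periods still leaves a full one, as the period exceeds 49.
    either (no p≮65)  = ¬Repeats-large curlingBlock (ternary ∘ suc) curling-recognizable (λ m → ternary-squareFree m ∘ suc)
      (s≤s (≮⇒≥ p≮65)) i (shifted i (Repeats-sub v rep (m≤n+m i 49) bound))
      where
      bound : 49 + i + suc p ≤ i + suc (2 * suc p)
      bound = begin
        49 + i + suc p                ≤⟨ +-monoˡ-≤ (suc p) (+-monoˡ-≤ i (≤-trans (m≤m+n 49 17) (s≤s (≮⇒≥ p≮65)))) ⟩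
        suc p + i + suc p             ≤⟨ n≤1+n _ ⟩
        suc (suc p + i + suc p)       ≡⟨ lemma p i ⟩
        i + suc (2 * suc p)           ∎
        where
        open ≤-Reasoning
        lemma : ∀ p i → suc (suc p + i + suc p) ≡ i + suc (2 * suc p)
        lemma = solve-∀

-- From exponents to repetitions.

-- Normalised fractions may have cancelled common factors; passing to unnormalised ones makes the
-- comparison a cross multiplication.
/<⇒*<* : ∀ b d n {p} (1≤p : 1 ≤ p) → + b / suc d ℚ.< ℚ._/_ (+ n) p {{ℕ.>-nonZero 1≤p}} → b * p < n * suc d
/<⇒*<* b d n {suc p} (s≤s z≤n) lt = drop‿+<+ (subst₂ ℤ._<_ (sym (pos-* b (suc p))) (sym (pos-* n (suc d)))
  (ℚᵘ.drop-*<* (ℚᵘ.<-respʳ-≃ (ℚ.toℚᵘ-fromℚᵘ (ℚᵘ.mkℚᵘ (+ n) p))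
    (ℚᵘ.<-respˡ-≃ (ℚ.toℚᵘ-fromℚᵘ (ℚᵘ.mkℚᵘ (+ b) d)) (ℚ.toℚᵘ-mono-< lt)))))

HasPeriod⇒Repeats : ∀ (w : InfiniteWord A) {i n p l} → HasPeriod (factor w i n) p → p + l ≤ n → Repeats w p i l
HasPeriod⇒Repeats w {i} {n} {p} {l} period p+l≤n = applyUpTo-cong l λ {j} j<l → begin
  w (i + j)                ≡⟨ at (j<length (≤-trans j<l (m≤n+m l p))) ⟨
  lookup x (fromℕ< _)      ≡⟨ HasPeriod.periodic period _ _ (trans (toℕ-fromℕ< (j+p<length j<l)) (cong (_+ p) (sym (toℕ-fromℕ< (j<length (≤-trans j<l (m≤n+m l p))))))) ⟩
  lookup x (fromℕ< _)      ≡⟨ at (j+p<length j<l) ⟩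
  w (i + (j + p))          ≡⟨ cong w (trans (sym (+-assoc i j p)) (+-swapʳ i j p)) ⟩
  w (i + p + j)            ∎
  where
  open ≡-Reasoning
  x = factor w i n
  at : ∀ {j} (j< : j < length x) → lookup x (fromℕ< j<) ≡ w (i + j)
  at j< = trans (lookup-applyUpTo _ n (fromℕ< j<)) (cong (λ j → w (i + j)) (toℕ-fromℕ< j<))
  j<length : ∀ {j} → j < p + l → j < length x
  j<length j< = ≤-trans j< (≤-trans p+l≤n (≤-reflexive (sym (length-applyUpTo _ n))))
  j+p<length : ∀ {j} → j < l → j + p < length x
  j+p<length {j} j<l = j<length (subst (j + p <_) (+-comm l p) (+-monoˡ-< p j<l))

-- A factor of length `n` and period `p` overlaps its shift by `p` in `n - p` letters, and `bound`
-- turns too large an exponent `n / p` into `n - p ≥ l p`.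
¬Repeats⇒⁺-free : ∀ b d (w : InfiniteWord A) (l : ℕ → ℕ) → (∀ {p n} → b * suc p < n * suc d → suc p + l (suc p) ≤ n) →
                  (∀ p i → ¬ Repeats w (suc p) i (l (suc p))) → (+ b / suc d) ⁺-free w
¬Repeats⇒⁺-free b d w l bound ¬rep (_ , (i , n , refl) , _ , _ , (suc p , period , refl) , lt) =
  ¬rep p i (HasPeriod⇒Repeats w hasPeriod
    (bound (/<⇒*<* b d n 1≤p (subst (λ k → + b / suc d ℚ.< ℚ._/_ (+ k) (suc p) {{ℕ.>-nonZero 1≤p}}) (length-applyUpTo _ n) lt))))
  where open IsLeastPeriod period
¬Repeats⇒⁺-free _ _ _ _ _ _ (_ , _ , _ , _ , (zero , period , _) , _) = contradiction (IsLeastPeriod.1≤p period) λ ()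

theorem5 : Σ[ w ∈ InfiniteWord (Fin 2) ] (+ 5 / 2) ⁺-free w × (+ 3 / 1) ⁺-free C _≟_ w
theorem5 = binaryWord ,
  ¬Repeats⇒⁺-free 5 1 binaryWord (λ p → suc (3 * p ℕ./ 2)) bound₅ binary-¬Repeats ,
  ¬Repeats⇒⁺-free 3 0 (C _≟_ binaryWord) (λ p → suc (2 * p)) bound₃ (curling-¬Repeats (C _≟_ binaryWord) C-prefix C-block)
  where
  bound₅ : ∀ {p n} → 5 * suc p < n * 2 → suc p + suc (3 * suc p ℕ./ 2) ≤ n
  -- Doubling both sides disposes of the floor: twice the rounded half is at most `3 * suc p`.
  bound₅ {p} {n} lt = *-cancelʳ-< 2 (p + suc (3 * suc p ℕ./ 2)) n (begin-strict
    (p + suc h) * 2             ≡⟨ lemma p h ⟩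
    2 * suc p + h * 2           ≤⟨ +-monoʳ-≤ (2 * suc p) (m/n*n≤m (3 * suc p) 2) ⟩
    2 * suc p + 3 * suc p       ≡⟨ *-distribʳ-+ (suc p) 2 3 ⟨
    5 * suc p                   <⟨ lt ⟩
    n * 2                       ∎)
    where
    open ≤-Reasoning
    h = 3 * suc p ℕ./ 2
    lemma : ∀ p h → (p + suc h) * 2 ≡ 2 * suc p + h * 2
    lemma = solve-∀

  bound₃ : ∀ {p n} → 3 * suc p < n * 1 → suc p + suc (2 * suc p) ≤ n
  bound₃ {p} {n} lt = subst₂ _≤_ (sym (+-suc (suc p) (2 * suc p))) (*-identityʳ n) lt
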